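{- Let $m=p^s$ be a prime power with $p$ prime and $s\geq 3$, and let $k=p^{s-2}+1$. Then there exist constants $C_m>0$ and $0< c_m \leq m/2$ (depending only on $m$) such that for all integers $n\ge 1$ $$r_k(\mathbb{Z}_m^n)\geq C_m \frac{(m-2p^2+2p)^n}{n^{c_m}}.$$
   Context: $\mathbb{Z}_m^n$ denotes the additive group $(\mathbb{Z}/m\mathbb{Z})^n$. A proper arithmetic progression of length $k$ in $\mathbb{Z}_m^n$ is a sequence $x, x+d, \ldots, x+(k-1)d$ (with $x,d\in\mathbb{Z}_m^n$) whose $k$ elements are pairwise distinct. $r_k(\mathbb{Z}_m^n)$ denotes the maximal size of a set $S\subseteq\mathbb{Z}_m^n$ that does not contain a proper arithmetic progression of length $k$. -}

module Defs where

open import Data.Nat.Base as ℕ using (ℕ; zero; suc; NonZero)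
import Data.Nat.Properties as ℕ
open import Data.Nat.DivMod using (_mod_)
open import Data.Integer.Base as ℤ using (∣_∣)
open import Data.Rational.Base as ℚ using (ℚ; ↥_; ↧ₙ_; _/_)
open import Algebra.Definitions.RawSemiring ℚ.+-*-rawSemiring public using () renaming (_^_ to _^ℚ_)
open import Data.Fin.Base using (Fin; zero; suc; toℕ; funToFin; finToFun)
import Data.Fin.Properties as Fin
open import Data.Vec.Base as Vec using (Vec; []; _∷_; zipWith; toList; fromList)
import Data.Vec.Properties as Vec
open import Data.List.Base as List using (List; []; _∷_; length)
open import Data.List.Membership.Propositional using (_∈_)
open import Data.List.Membership.Propositional.Properties using (∈-lookup)
import Data.List.Membership.DecPropositional as DecMembership
open import Data.List.Relation.Unary.All as All using ()
open import Data.List.Relation.Unary.AllPairs using ([]; _∷_)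
open import Data.List.Relation.Unary.Unique.Propositional using (Unique)
import Data.List.Relation.Unary.Unique.DecPropositional as DecUnique
open import Data.Product.Base using (∃; ∃₂; _×_; _,_; proj₁; proj₂)
open import Data.Empty using (⊥-elim)
open import Function.Base using (_∘_)
open import Function.Definitions using (Injective)
open import Relation.Binary.Definitions using (DecidableEquality)
open import Relation.Binary.PropositionalEquality using (_≡_; refl; sym; trans; cong; subst)
open import Relation.Nullary using (¬_; Dec; yes; no)
open import Relation.Nullary.Decidable using (map′; ¬?; _×-dec_; _→-dec_)
open import Relation.Unary using (Decidable)

ℤ/_^_ : ℕ → ℕ → Set
ℤ/ m ^ n = Vec (Fin m) n

infixl 6 _+ₘ_ _⊕_

_+ₘ_ : ∀ {m} → Fin m → Fin m → Fin m
_+ₘ_ {m} a b = _mod_ (toℕ a ℕ.+ toℕ b) m {{Fin.nonZeroIndex a}}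

_⊕_ : ∀ {m n} → ℤ/ m ^ n → ℤ/ m ^ n → ℤ/ m ^ n
_⊕_ = zipWith _+ₘ_

-- term x d i = x + i·d
term : ∀ {m n} → ℤ/ m ^ n → ℤ/ m ^ n → ℕ → ℤ/ m ^ n
term x d zero    = x
term x d (suc i) = term x d i ⊕ d

progression : ∀ {m n} (k : ℕ) → ℤ/ m ^ n → ℤ/ m ^ n → Fin k → ℤ/ m ^ n
progression k x d i = term x d (toℕ i)

IsProper : ∀ {m n} (k : ℕ) → ℤ/ m ^ n → ℤ/ m ^ n → Set
IsProper k x d = Injective _≡_ _≡_ (progression k x d)

-- Finite subsets of ℤ/ m ^ n are represented by lists; wherever the size
-- matters the list is required to be Unique, so that its length is the
-- cardinality.
APFree : ∀ {m n} → ℕ → List (ℤ/ m ^ n) → Set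
APFree k S = ¬ (∃₂ λ x d → IsProper k x d × (∀ i → progression k x d i ∈ S))

IsMaxAPFreeSize : (k m n r : ℕ) → Set
IsMaxAPFreeSize k m n r =
    (∃ λ (S : List (ℤ/ m ^ n)) → Unique S × APFree k S × length S ≡ r)
  × (∀ (S : List (ℤ/ m ^ n)) → Unique S → APFree k S → length S ℕ.≤ r)

private

  Searchable : Set → Set₁
  Searchable A = ∀ {P : A → Set} → Decidable P → Dec (∃ P)

  searchVec : ∀ {A} → Searchable A → ∀ n → Searchable (Vec A n)
  searchVec search zero    P? = map′ ([] ,_) (λ { ([] , p) → p }) (P? [])
  searchVec search (suc n) P? =
    map′ (λ { (a , v , p) → a ∷ v , p }) (λ { (a ∷ v , p) → a , v , p })
      (search λ a → searchVec search n λ v → P? (a ∷ v))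

  searchList : ∀ {A} → Searchable A → ∀ j {P : List A → Set} → Decidable P →
               Dec (∃ λ S → P S × length S ≡ j)
  searchList search j {P} P? =
    map′ (λ { (v , p) → toList v , p , Vec.length-toList v })
         (λ { (S , p , refl) → fromList S , subst P (sym (Vec.toList∘fromList S)) p })
      (searchVec search j λ v → P? (toList v))

  search : ∀ {m n} → Searchable (ℤ/ m ^ n)
  search = searchVec Fin.any? _

  _≟_ : ∀ {m n} → DecidableEquality (ℤ/ m ^ n)
  _≟_ = Vec.≡-dec Fin._≟_

  isProper? : ∀ {m n} k (x d : ℤ/ m ^ n) → Dec (IsProper k x d)
  isProper? k x d =
    map′ (λ inj {i} {j} → inj i j) (λ inj i j → inj {i} {j})
      (Fin.all? λ i → Fin.all? λ j →
        (progression k x d i ≟ progression k x d j) →-dec (i Fin.≟ j))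

  apFree? : ∀ {m n} k → Decidable (APFree {m} {n} k)
  apFree? k S =
    ¬? (search λ x → search λ d →
         isProper? k x d ×-dec Fin.all? λ i → progression k x d i ∈? S)
    where open DecMembership _≟_ using (_∈?_)

  lookup-injective : ∀ {A : Set} {S : List A} → Unique S → Injective _≡_ _≡_ (List.lookup S)
  lookup-injective (x∉S ∷ u) {zero}  {zero}  eq = refl
  lookup-injective (x∉S ∷ u) {zero}  {suc j} eq = ⊥-elim (All.lookup x∉S (∈-lookup j) eq)
  lookup-injective (x∉S ∷ u) {suc i} {zero}  eq = ⊥-elim (All.lookup x∉S (∈-lookup i) (sym eq))
  lookup-injective (x∉S ∷ u) {suc i} {suc j} eq = cong suc (lookup-injective u eq)

  funToFin-lookup-injective : ∀ {m n} {u v : ℤ/ m ^ n} →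
    funToFin (Vec.lookup u) ≡ funToFin (Vec.lookup v) → u ≡ v
  funToFin-lookup-injective {u = u} {v} eq =
    trans (sym (Vec.tabulate∘lookup u)) (trans (Vec.tabulate-cong same) (Vec.tabulate∘lookup v))
    where
    same : ∀ i → Vec.lookup u i ≡ Vec.lookup v i
    same i = trans (sym (Fin.finToFun-funToFin (Vec.lookup u) i))
            (trans (cong (λ c → finToFun c i) eq) (Fin.finToFun-funToFin (Vec.lookup v) i))

  length≤m^n : ∀ {m n} (S : List (ℤ/ m ^ n)) → Unique S → length S ℕ.≤ m ℕ.^ n
  length≤m^n S u = Fin.injective⇒≤ {f = funToFin ∘ Vec.lookup ∘ List.lookup S}
    (lookup-injective u ∘ funToFin-lookup-injective)

  greatest : ∀ {Q : ℕ → Set} → Decidable Q → Q 0 → ∀ b → (∀ j → Q j → j ℕ.≤ b) →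
             ∃ λ r → Q r × (∀ j → Q j → j ℕ.≤ r)
  greatest Q? q₀ zero    bound = 0 , q₀ , bound
  greatest {Q} Q? q₀ (suc b) bound with Q? (suc b)
  ... | yes q = suc b , q , bound
  ... | no ¬q = greatest Q? q₀ b λ j q →
          ℕ.≤-pred (ℕ.≤∧≢⇒< (bound j q) λ j≡ → ¬q (subst Q j≡ q))

abstract

  -- For k = 0 there is no maximum: every set contains the empty progression.
  maxAPFreeSize : ∀ k m n .{{_ : NonZero k}} → ∃ (IsMaxAPFreeSize k m n)
  maxAPFreeSize (suc k) m n =
    let r , (S , (u , f) , len) , max = greatest size? empty (m ℕ.^ n) bound
    in r , (S , u , f , len) , λ S u f → max (length S) (S , (u , f) , refl)
    where
    Good : List (ℤ/ m ^ n) → Set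
    Good S = Unique S × APFree (suc k) S

    HasSize : ℕ → Set
    HasSize j = ∃ λ S → Good S × length S ≡ j

    size? : Decidable HasSize
    size? j = searchList search j λ S → DecUnique.unique? _≟_ S ×-dec apFree? (suc k) S

    empty : HasSize 0
    empty = [] , ([] , λ { (x , d , _ , x∈[]) → ∉[] (x∈[] zero) }) , refl
      where
      ∉[] : ∀ {y : ℤ/ m ^ n} → ¬ (y ∈ [])
      ∉[] ()

    bound : ∀ j → HasSize j → j ℕ.≤ m ℕ.^ n
    bound _ (S , (u , _) , refl) = length≤m^n S u

-- r k m n is the number r_k(ℤ_m^n); proj₂ (maxAPFreeSize k m n) is its
-- defining property.
r : ∀ k m n .{{_ : NonZero k}} → ℕ
r k m n = proj₁ (maxAPFreeSize k m n)

fromℕ : ℕ → ℚ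
fromℕ n = ℤ.+ n / 1

-- y ≥ x ÷ n ^^ c is the real inequality y ≥ x / n ^ c, for x ≥ 0, n ≥ 1 and
-- c > 0.  With c = a / b in lowest terms, it is multiplied by n ^ c and raised
-- to the power b, which is an equivalence between nonnegative numbers and
-- leaves only natural exponents: x ^ b ≤ y ^ b · n ^ a.
infix 4 _≥_÷_^^_

_≥_÷_^^_ : ℕ → ℚ → ℕ → ℚ → Set
y ≥ x ÷ n ^^ c = x ^ℚ b ℚ.≤ fromℕ y ^ℚ b ℚ.* fromℕ n ^ℚ a
  where
  a = ∣ ↥ c ∣
  b = ↧ₙ c

{-# OPTIONS --safe #-}
module Submission where

-- Write q = p^(s-2).  The admissible coordinates are the residues x mod p^s
-- that are < p^e as soon as their residue mod p^(s-2+e) is, for e = 0 and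
-- e = 1.  This excludes (p² - 1) + (p - 1)² = 2p² - 2p residues.  By pigeonhole,
-- at least (n+1)^(-2(s-2)) of the vectors with admissible coordinates agree in
-- the statistics "number of coordinates whose residue mod p^(e+j) is < p^e", for
-- e ≤ 1 and 1 ≤ j ≤ s - 2.  If these vectors contain x, x + d, ..., x + qd and
-- p^e divides d (e ≤ 1), then p^(e+1) divides d: for a coordinate of d where
-- this fails, one shows by descending induction on j that the coordinate of x
-- is not < p^e modulo p^(e+j), which is absurd for j = 0.  Hence p² divides d,
-- so x + qd = x and the progression is not proper.

open import Defs
open import Data.Nat.Base using (ℕ; suc; _+_; _*_; _∸_; _^_; _≤_)
open import Data.Nat.Primality using (Prime)
open import Data.Integer.Base using (+_)
open import Data.Rational.Base as ℚ using (ℚ; 0ℚ; _/_)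
open import Data.Product.Base using (∃₂; _×_)

open import Algebra.Bundles using (CommutativeRing)
open import Data.Empty using (⊥-elim)
open import Data.Fin.Base as Fin using (Fin; toℕ)
import Data.Fin.Properties as Fin
import Data.Integer.Base as ℤ
import Data.Integer.Properties as ℤ
open import Data.List.Base as List using (List; []; _∷_; _++_; length; map; filter; upTo; allFin; cartesianProductWith)
open import Data.List.Properties using (length-++; length-map; length-upTo; length-tabulate)
open import Data.List.Membership.Propositional using (_∈_)
open import Data.List.Membership.Propositional.Properties
open import Data.List.Relation.Binary.Sublist.Propositional using (_⊆_; []; _∷_; _∷ʳ_; ⊆-refl; ⊆-trans)
open import Data.List.Relation.Binary.Sublist.Propositional.Properties using (filter-⊆; All-resp-⊆)
open import Data.List.Relation.Unary.All as All using (All; []; _∷_)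
import Data.List.Relation.Unary.All.Properties as All
open import Data.List.Relation.Unary.AllPairs using ([]; _∷_)
open import Data.List.Relation.Unary.Any using (here; there; index)
open import Data.List.Relation.Unary.Any.Properties using (lookup-index)
open import Data.List.Relation.Unary.Unique.Propositional using (Unique)
import Data.List.Relation.Unary.Unique.Propositional.Properties as Unique
open import Data.Nat.Base using (zero; pred; _<_; s≤s; s≤s⁻¹; z≤n; _%_; NonZero; nonTrivial⇒n>1) renaming (_/_ to _/ℕ_)
open import Data.Nat.Coprimality as Coprimality using (Coprime; coprime-Bézout; 1-coprimeTo)
open import Data.Nat.Divisibility
open import Data.Nat.DivMod hiding (_/_; _%_)
open import Data.Nat.GCD using (module Bézout)
open import Data.Nat.Primality using (prime⇒nonZero; prime⇒nonTrivial; prime⇒irreducible)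
open import Data.Nat.Properties
open import Data.Nat.Solver using (module +-*-Solver)
open import Data.Product.Base using (∃; _,_; proj₁; proj₂)
open import Data.Rational.Base using (½; mkℚ; *≤*; Positive)
import Data.Rational.Properties as ℚ
import Data.Rational.Unnormalised.Base as ℚᵘ
import Data.Rational.Unnormalised.Properties as ℚᵘ
open import Data.Sum.Base using (inj₁; inj₂)
open import Data.Vec.Base as Vec using (Vec; []; _∷_; lookup)
open import Data.Vec.Properties using (∷-injective; lookup-zipWith; tabulate∘lookup; tabulate-cong; count≤n)
open import Function.Base using (_∘_)
open import Relation.Binary.PropositionalEquality
open import Relation.Nullary using (¬_; Dec; yes; no; ¬?)
open import Relation.Nullary.Decidable using (_×-dec_; _→-dec_)
open import Relation.Unary using (Decidable)

open import Algebra.Properties.CommutativeSemiring.Exp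
  (CommutativeRing.commutativeSemiring ℚ.+-*-commutativeRing) using (^-distrib-*)

-- Pigeonhole principle for lists.

module _ {A : Set} where

  length-filter-split : ∀ {P : A → Set} (P? : Decidable P) xs →
    length (filter P? xs) + length (filter (¬? ∘ P?) xs) ≡ length xs
  length-filter-split P? []       = refl
  length-filter-split P? (x ∷ xs) with P? x
  ... | yes _ = cong suc (length-filter-split P? xs)
  ... | no  _ = trans (+-suc _ _) (cong suc (length-filter-split P? xs))

  lookup-injective : ∀ {xs : List A} → Unique xs → ∀ {i j} → List.lookup xs i ≡ List.lookup xs j → i ≡ j
  lookup-injective (x∉xs ∷ u) {Fin.zero}  {Fin.zero}  eq = refl
  lookup-injective (x∉xs ∷ u) {Fin.zero}  {Fin.suc j} eq = ⊥-elim (All.lookup x∉xs (∈-lookup j) eq)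
  lookup-injective (x∉xs ∷ u) {Fin.suc i} {Fin.zero}  eq = ⊥-elim (All.lookup x∉xs (∈-lookup i) (sym eq))
  lookup-injective (x∉xs ∷ u) {Fin.suc i} {Fin.suc j} eq = cong Fin.suc (lookup-injective u eq)

  -- Sending each index of `xs` to a position of the same element in `ys` is injective, as `xs` has
  -- no repetitions.
  unique⇒length≤ : ∀ {xs ys : List A} → Unique xs → (∀ {x} → x ∈ xs → x ∈ ys) → length xs ≤ length ys
  unique⇒length≤ {xs} {ys} u sub = Fin.injective⇒≤ {f = λ i → index (position i)} λ {i} {j} eq →
    lookup-injective u (trans (lookup-index (position i))
      (trans (cong (List.lookup ys) eq) (sym (lookup-index (position j)))))
    where
    position : ∀ i → List.lookup xs i ∈ ys
    position i = sub (∈-lookup i)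

  ConstantOn : List A → (A → ℕ) → Set
  ConstantOn xs f = ∃ λ v → All (λ x → f x ≡ v) xs

  -- Induction on the number of values: the entries with value `b` compete with the sublist found
  -- among the other entries, and the longer one is kept. The result is a sublist, so that
  -- distinctness and admissibility of the entries pass to it.
  pigeonhole : ∀ (f : A → ℕ) b xs → All (λ x → f x < b) xs →
    ∃ λ ys → ys ⊆ xs × ConstantOn ys f × length xs ≤ length ys * b
  pigeonhole f zero    []       []       = [] , ⊆-refl , (0 , []) , z≤n
  pigeonhole f (suc b) xs       f<1+b
    with pigeonhole f b (filter (λ x → ¬? (f x ≟ b)) xs)
           (All.map (λ { (f<1+b , f≢b) → ≤∧≢⇒< (s≤s⁻¹ f<1+b) f≢b })
             (All.zip (All.filter⁺ _ f<1+b , All.all-filter _ xs)))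
  ... | ys , ys⊆ , (v , f≡v) , bound with ≤-total (length (filter (λ x → f x ≟ b) xs)) (length ys)
  ... | inj₁ fibre≤ = ys , ⊆-trans ys⊆ (filter-⊆ _ xs) , (v , f≡v) , (begin
    length xs                        ≡⟨ length-filter-split (λ x → f x ≟ b) xs ⟨
    length (filter (λ x → f x ≟ b) xs) + _ ≤⟨ +-mono-≤ fibre≤ bound ⟩
    length ys + length ys * b        ≡⟨ *-suc (length ys) b ⟨
    length ys * suc b                ∎)
    where open ≤-Reasoning
  ... | inj₂ ≤fibre = zs , filter-⊆ _ xs , (b , All.all-filter _ xs) , (begin
    length xs                        ≡⟨ length-filter-split (λ x → f x ≟ b) xs ⟨
    length zs + _                    ≤⟨ +-monoʳ-≤ (length zs) (≤-trans bound (*-monoˡ-≤ b ≤fibre)) ⟩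
    length zs + length zs * b        ≡⟨ *-suc (length zs) b ⟨
    length zs * suc b                ∎)
    where
    open ≤-Reasoning
    zs = filter (λ x → f x ≟ b) xs

  -- The functions are made constant one after another, each at the cost of a factor `b`; constancy
  -- already obtained survives because it passes to sublists.
  pigeonholes : ∀ (fs : List (A → ℕ)) b xs → All (λ f → ∀ x → f x < b) fs →
    ∃ λ ys → ys ⊆ xs × All (ConstantOn ys) fs × length xs ≤ length ys * b ^ length fs
  pigeonholes []       b xs []          = xs , ⊆-refl , [] , ≤-reflexive (sym (*-identityʳ _))
  pigeonholes (f ∷ fs) b xs (f<b ∷ fs<b)
    with ys , ys⊆xs , (v , f≡v) , bound ← pigeonhole f b xs (All.universal f<b xs)
    with zs , zs⊆ys , const , bound′ ← pigeonholes fs b ys fs<b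
    = zs , ⊆-trans zs⊆ys ys⊆xs , (v , All-resp-⊆ zs⊆ys f≡v) ∷ const , (begin
    length xs                                ≤⟨ bound ⟩
    length ys * b                            ≤⟨ *-monoˡ-≤ b bound′ ⟩
    length zs * b ^ length fs * b            ≡⟨ *-assoc (length zs) _ b ⟩
    length zs * (b ^ length fs * b)          ≡⟨ cong (length zs *_) (*-comm _ b) ⟩
    length zs * b ^ suc (length fs)          ∎)
    where open ≤-Reasoning

  -- Vectors with coordinates from a list.

  vectors : List A → ∀ n → List (Vec A n)
  vectors xs zero    = [] ∷ []
  vectors xs (suc n) = cartesianProductWith _∷_ xs (vectors xs n)

  vectors-unique : ∀ {xs} → Unique xs → ∀ n → Unique (vectors xs n)
  vectors-unique u zero    = [] ∷ []
  vectors-unique u (suc n) = Unique.cartesianProductWith⁺ _∷_ ∷-injective u (vectors-unique u n)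

length-cartesianProductWith : ∀ {A B C : Set} (f : A → B → C) xs ys →
  length (cartesianProductWith f xs ys) ≡ length xs * length ys
length-cartesianProductWith f []       ys = refl
length-cartesianProductWith f (x ∷ xs) ys =
  trans (length-++ (map (f x) ys))
    (cong₂ _+_ (length-map (f x) ys) (length-cartesianProductWith f xs ys))

length-vectors : ∀ {A : Set} (xs : List A) n → length (vectors xs n) ≡ length xs ^ n
length-vectors xs zero    = refl
length-vectors xs (suc n) =
  trans (length-cartesianProductWith _∷_ xs (vectors xs n)) (cong (length xs *_) (length-vectors xs n))

lookup∈ : ∀ {A : Set} {xs : List A} n → All (λ v → ∀ j → lookup v j ∈ xs) (vectors xs n)
lookup∈ zero    = (λ ()) ∷ []
lookup∈ (suc n) = All.cartesianProductWith⁺ (setoid _) (setoid _) _∷_ _ _ λ x∈ v∈ →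
  λ { Fin.zero → x∈ ; (Fin.suc j) → All.lookup (lookup∈ n) v∈ j }

unique-resp-⊆ : ∀ {A : Set} {xs ys : List A} → xs ⊆ ys → Unique ys → Unique xs
unique-resp-⊆ []           []         = []
unique-resp-⊆ (_ ∷ʳ sub)   (_ ∷ u)    = unique-resp-⊆ sub u
unique-resp-⊆ (refl ∷ sub) (x∉ys ∷ u) = All-resp-⊆ sub x∉ys ∷ unique-resp-⊆ sub u

-- Counting coordinates with a given property.

module _ {A : Set} {P : A → Set} (P? : Decidable P) where

  count-mono-≤ : ∀ {n} (u v : Vec A n) → (∀ j → P (lookup u j) → P (lookup v j)) →
    Vec.count P? u ≤ Vec.count P? v
  count-mono-≤ []      []      imp = z≤n
  count-mono-≤ (x ∷ u) (y ∷ v) imp with P? x | P? y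
  ... | yes p | yes q = s≤s (count-mono-≤ u v (imp ∘ Fin.suc))
  ... | yes p | no ¬q = ⊥-elim (¬q (imp Fin.zero p))
  ... | no ¬p | yes q = m≤n⇒m≤1+n (count-mono-≤ u v (imp ∘ Fin.suc))
  ... | no ¬p | no ¬q = count-mono-≤ u v (imp ∘ Fin.suc)

  -- The positions where `P` holds in `u` are among those where it holds in `v`; two finite sets of
  -- equal size, one inside the other, coincide.
  count-≡⇒converse : ∀ {n} (u v : Vec A n) → (∀ j → P (lookup u j) → P (lookup v j)) →
    Vec.count P? u ≡ Vec.count P? v → ∀ j → P (lookup v j) → P (lookup u j)
  count-≡⇒converse (x ∷ u) (y ∷ v) imp eq j with P? x | P? y
  count-≡⇒converse (x ∷ u) (y ∷ v) imp eq Fin.zero    | yes p | _     = λ _ → p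
  count-≡⇒converse (x ∷ u) (y ∷ v) imp eq Fin.zero    | no ¬p | no ¬q = ⊥-elim ∘ ¬q
  count-≡⇒converse (x ∷ u) (y ∷ v) imp eq (Fin.suc j) | yes p | yes q =
    count-≡⇒converse u v (imp ∘ Fin.suc) (suc-injective eq) j
  count-≡⇒converse (x ∷ u) (y ∷ v) imp eq (Fin.suc j) | yes p | no ¬q = ⊥-elim (¬q (imp Fin.zero p))
  count-≡⇒converse (x ∷ u) (y ∷ v) imp eq (Fin.suc j) | no ¬p | no ¬q =
    count-≡⇒converse u v (imp ∘ Fin.suc) eq j
  -- A position gained at the head makes the count of `v` strictly larger, against `eq`.
  count-≡⇒converse (x ∷ u) (y ∷ v) imp eq j           | no ¬p | yes q =
    ⊥-elim (<⇒≢ (s≤s (count-mono-≤ u v (imp ∘ Fin.suc))) eq)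

-- Linear congruences modulo a prime.

prime∤⇒coprime : ∀ {p d} → Prime p → ¬ p ∣ d → Coprime d p
prime∤⇒coprime pr p∤d (i∣d , i∣p) with prime⇒irreducible pr i∣p
... | inj₁ i≡1 = i≡1
... | inj₂ refl = ⊥-elim (p∤d i∣d)

negated-inverse : ∀ {p d} .{{_ : NonZero p}} → Coprime d p → ∃ λ w → p ∣ 1 + w * d
negated-inverse {suc k} {d} c with coprime-Bézout c
... | Bézout.-+ x y eq = x , divides y eq
-- Here `x` is an inverse of `d` modulo `p = suc k`; since `k` is -1 modulo `p`, multiplying by it
-- changes the sign.
... | Bézout.+- x y eq = k * x , divides (1 + k * y) (begin
  1 + k * x * d               ≡⟨ cong suc (*-assoc k x d) ⟩
  1 + k * (x * d)             ≡⟨ cong (λ z → 1 + k * z) eq ⟨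
  1 + k * (1 + y * suc k)
    ≡⟨ solve 2 (λ k y → con 1 :+ k :* (con 1 :+ y :* (con 1 :+ k)) := (con 1 :+ k :* y) :* (con 1 :+ k)) refl k y ⟩
  (1 + k * y) * suc k         ∎)
  where
  open ≡-Reasoning
  open +-*-Solver

-- With `w` congruent to -1/d, the choice `l = u * w % p` works, because u + u·w·d = u·(1 + w·d).
solve-mod : ∀ {p d} .{{_ : NonZero p}} → Coprime d p → ∀ u → ∃ λ l → l < p × p ∣ u + l * d
solve-mod {p} {d} c u with w , p∣ ← negated-inverse c = l , m%n<n _ p , m%n≡0⇒n∣m _ p (begin
  (u + l * d) % p                     ≡⟨ %-distribˡ-+ u (l * d) p ⟩
  (u % p + l * d % p) % p             ≡⟨ cong (λ z → (u % p + z) % p) (%-distribˡ-* l d p) ⟩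
  (u % p + (l % p) * (d % p) % p) % p ≡⟨ cong (λ z → (u % p + z * (d % p) % p) % p) (m%n%n≡m%n (u * w) p) ⟩
  (u % p + (u * w % p) * (d % p) % p) % p ≡⟨ cong (λ z → (u % p + z) % p) (%-distribˡ-* (u * w) d p) ⟨
  (u % p + u * w * d % p) % p         ≡⟨ %-distribˡ-+ u (u * w * d) p ⟨
  (u + u * w * d) % p
    ≡⟨ cong (_% p) (solve 3 (λ u w d → u :+ u :* w :* d := u :* (con 1 :+ w :* d)) refl u w d) ⟩
  (u * (1 + w * d)) % p               ≡⟨ n∣m⇒m%n≡0 _ p (∣n⇒∣m*n u p∣) ⟩
  0                                   ∎)
  where
  open ≡-Reasoning
  open +-*-Solver
  l = u * w % p

-- Progressions coordinate by coordinate, as residues.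

lookup-ext : ∀ {A : Set} {n} {u v : Vec A n} → (∀ j → lookup u j ≡ lookup v j) → u ≡ v
lookup-ext eq = trans (sym (tabulate∘lookup _)) (trans (tabulate-cong eq) (tabulate∘lookup _))

toℕ-term : ∀ {m n} .{{_ : NonZero m}} (x d : ℤ/ m ^ n) i j →
  toℕ (lookup (term x d i) j) ≡ (toℕ (lookup x j) + i * toℕ (lookup d j)) % m
toℕ-term {m} x d zero    j =
  trans (sym (m<n⇒m%n≡m (Fin.toℕ<n (lookup x j)))) (cong (_% m) (sym (+-identityʳ _)))
toℕ-term {m} x d (suc i) j = begin
  toℕ (lookup (term x d i ⊕ d) j)                ≡⟨ cong toℕ (lookup-zipWith _+ₘ_ j (term x d i) d) ⟩
  toℕ (lookup (term x d i) j +ₘ lookup d j)      ≡⟨ Fin.toℕ-fromℕ< _ ⟩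
  (toℕ (lookup (term x d i) j) + D) % m          ≡⟨ cong (λ z → (z + D) % m) (toℕ-term x d i j) ⟩
  ((X + i * D) % m + D) % m                      ≡⟨ %-distribˡ-+ _ D m ⟩
  ((X + i * D) % m % m + D % m) % m              ≡⟨ cong (λ z → (z + D % m) % m) (m%n%n≡m%n (X + i * D) m) ⟩
  ((X + i * D) % m + D % m) % m                  ≡⟨ %-distribˡ-+ _ D m ⟨
  (X + i * D + D) % m
    ≡⟨ cong (_% m) (trans (+-assoc X _ D) (cong (λ z → X + z) (+-comm _ D))) ⟩
  (X + suc i * D) % m                            ∎
  where
  open ≡-Reasoning
  X = toℕ (lookup x j)
  D = toℕ (lookup d j)

^-monoʳ-∣ : ∀ p {a b} → a ≤ b → p ^ a ∣ p ^ b
^-monoʳ-∣ p {a} {b} a≤b = divides (p ^ (b ∸ a))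
  (trans (cong (p ^_) (sym (m∸n+n≡m a≤b))) (^-distribˡ-+-* p (b ∸ a) a))

[x+z]%m≡x⇒m∣z : ∀ {m} x z .{{_ : NonZero m}} → (x + z) % m ≡ x → m ∣ z
[x+z]%m≡x⇒m∣z {m} x z eq = divides ((x + z) /ℕ m) (+-cancelˡ-≡ x _ _
  (trans (m≡m%n+[m/n]*n (x + z) m) (cong (_+ (x + z) /ℕ m * m) eq)))

-- Low residues along a progression.

module _ {p : ℕ} (p-prime : Prime p) where

  private instance
    p≢0 : NonZero p
    p≢0 = prime⇒nonZero p-prime

  -- In base `p`: the `j` digits of `x` from position `e` upwards vanish. For `j = 0` this always
  -- holds.
  Low : ℕ → ℕ → ℕ → Set
  Low e j x = _%_ x (p ^ (e + j)) {{m^n≢0 p (e + j)}} < p ^ e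

  Low? : ∀ e j x → Dec (Low e j x)
  Low? e j x = _ <? _

  p^suc : ∀ e j → p ^ (e + suc j) ≡ p * p ^ (e + j)
  p^suc e j = cong (p ^_) (+-suc e j)

  -- Write x = ρ + u·p^(e+j) with ρ < p^e, and d = d'·p^e with d' prime to p. Adding l·p^j·d turns u
  -- into u + l·d', which a suitable l < p makes divisible by p; the residue modulo p^(e+j+1) is
  -- then ρ.
  low-reach : ∀ {e j x d} → p ^ e ∣ d → ¬ p ^ suc e ∣ d → Low e j x →
    ∃ λ l → l < p × Low e (suc j) (x + l * p ^ j * d)
  low-reach {e} {j} {x} (divides-refl d) p∤ low
    with l , l<p , divides k eq ←
      solve-mod {p} {d} (prime∤⇒coprime p-prime (p∤ ∘ *-monoˡ-∣ (p ^ e)))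
        (_/ℕ_ x (p ^ (e + j)) {{m^n≢0 p (e + j)}})
    = l , l<p , (begin-strict
    (x + l * p ^ j * (d * p ^ e)) % p ^ (e + suc j) ≡⟨ cong (_% p ^ (e + suc j)) (begin-equality
      x + l * p ^ j * (d * p ^ e)         ≡⟨ cong (_+ l * p ^ j * (d * p ^ e)) (m≡m%n+[m/n]*n x M) ⟩
      ρ + u * M + l * p ^ j * (d * p ^ e) ≡⟨ cong (λ z → ρ + u * z + l * p ^ j * (d * p ^ e)) (^-distribˡ-+-* p e j) ⟩
      ρ + u * (p ^ e * p ^ j) + l * p ^ j * (d * p ^ e)
        ≡⟨ solve 6 (λ ρ u l d a b → ρ :+ u :* (a :* b) :+ l :* b :* (d :* a) := ρ :+ (u :+ l :* d) :* (a :* b))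
             refl ρ u l d (p ^ e) (p ^ j) ⟩
      ρ + (u + l * d) * (p ^ e * p ^ j)   ≡⟨ cong (λ z → ρ + z * (p ^ e * p ^ j)) eq ⟩
      ρ + k * p * (p ^ e * p ^ j)         ≡⟨ cong (λ z → ρ + z) (*-assoc k p _) ⟩
      ρ + k * (p * (p ^ e * p ^ j))       ≡⟨ cong (λ z → ρ + k * (p * z)) (^-distribˡ-+-* p e j) ⟨
      ρ + k * (p * M)                     ≡⟨ cong (λ z → ρ + k * z) (p^suc e j) ⟨
      ρ + k * p ^ (e + suc j)             ∎) ⟩
    (ρ + k * p ^ (e + suc j)) % p ^ (e + suc j) ≡⟨ [m+kn]%n≡m%n ρ k (p ^ (e + suc j)) ⟩
    ρ % p ^ (e + suc j)                    ≤⟨ m%n≤m ρ (p ^ (e + suc j)) ⟩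
    ρ                                      <⟨ low ⟩
    p ^ e                                  ∎)
    where
    open ≤-Reasoning
    open +-*-Solver
    instance
      _ = m^n≢0 p (e + j)
      _ = m^n≢0 p (e + suc j)
    M = p ^ (e + j)
    ρ = x % M
    u = x /ℕ M

  low-+ : ∀ {e j x z} → p ^ (e + j) ∣ z → Low e j x → Low e j (x + z)
  low-+ {e} {j} {x} {z} p∣z = subst (_< p ^ e) (sym (%-remove-+ʳ x p∣z))
    where instance _ = m^n≢0 p (e + j)

  -- Admissibility of a coordinate, where `t` is s - 3: a multiple of p^(s-2) must be 0, and a
  -- number with residue below p modulo p^(s-1) must itself be below p.
  Digit : ℕ → ℕ → Set
  Digit t x = (Low 0 (suc t) x → x < p ^ 0) × (Low 1 (suc t) x → x < p ^ 1)

  Digit? : ∀ t → Decidable (Digit t)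
  Digit? t x = (Low? 0 (suc t) x →-dec _ <? _) ×-dec (Low? 1 (suc t) x →-dec _ <? _)

  digit-low : ∀ {t x e} → e < 2 → Digit t x → Low e (suc t) x → x < p ^ e
  digit-low {e = 0} _ = proj₁
  digit-low {e = 1} _ = proj₂
  digit-low {e = suc (suc _)} (s≤s (s≤s ()))

  lowCount : ∀ {m n} → ℕ → ℕ → ℤ/ m ^ n → ℕ
  lowCount e j = Vec.count (Low? e j ∘ toℕ)

  module _ (t : ℕ) {n} (x d : ℤ/ (p ^ (3 + t)) ^ n)
    (digit : ∀ {i} → i ≤ p ^ suc t → ∀ j → Digit t (toℕ (lookup (term x d i) j)))
    (balanced : ∀ {e l i} → e < 2 → l < suc t → i ≤ p ^ suc t →
      lowCount e (suc l) x ≡ lowCount e (suc l) (term x d i))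
    where

    private
      m = p ^ (3 + t)
      q = p ^ suc t
      X D : Fin n → ℕ
      X j = toℕ (lookup x j)
      D j = toℕ (lookup d j)
      Y : ℕ → Fin n → ℕ
      Y i j = toℕ (lookup (term x d i) j)
      instance
        _ = m^n≢0 p (3 + t)

    qp²≡m : q * p ^ 2 ≡ m
    qp²≡m = trans (sym (^-distribˡ-+-* p (suc t) 2)) (cong (p ^_) (+-comm (suc t) 2))

    -- Reduction modulo `m` in the progression is invisible modulo `p ^ k`, a divisor of `m`.
    residue-term : ∀ {k} i j → k ≤ 3 + t →
      _%_ (Y i j) (p ^ k) {{m^n≢0 p k}} ≡ _%_ (X j + i * D j) (p ^ k) {{m^n≢0 p k}}
    residue-term {k} i j k≤ = trans (cong (_% p ^ k) (toℕ-term x d i j))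
      (m∣n⇒o%n%m≡o%m (p ^ k) m (X j + i * D j) (^-monoʳ-∣ p k≤))
      where instance _ = m^n≢0 p k

    -- From divisibility by p^e to divisibility by p^(e+1).

    module _ {e} (e<2 : e < 2) (p^e∣D : ∀ j → p ^ e ∣ D j) where

      e+l≤3+t : ∀ {l} → l ≤ 2 + t → e + l ≤ 3 + t
      e+l≤3+t = +-mono-≤ (s≤s⁻¹ e<2)

      -- Since p^(e+s-2) divides q·d, the last term is low here as well. Admissibility puts both
      -- coordinates below p^e, and being congruent modulo p^(e+s-2) they are equal. So m = q·p²
      -- divides q·d, hence p² divides d, although p^(e+1) does not.
      ¬low-top : ∀ j → ¬ p ^ suc e ∣ D j → ¬ Low e (suc t) (X j)
      ¬low-top j p∤ low = p∤ (∣-trans (^-monoʳ-∣ p e<2) p²∣Dj)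
        where
        instance
          _ = m^n≢0 p (e + suc t)
          _ = m^n≢0 p (suc t)
        p∣qDj : p ^ (e + suc t) ∣ q * D j
        p∣qDj = subst (_∣ q * D j) (trans (*-comm q (p ^ e)) (sym (^-distribˡ-+-* p e (suc t))))
          (*-monoʳ-∣ q (p^e∣D j))
        low-last : Low e (suc t) (Y q j)
        low-last = subst (_< p ^ e) (sym (residue-term q j (e+l≤3+t (n≤1+n _))))
          (low-+ {e} {suc t} p∣qDj low)
        reduce : ∀ {y} → y < p ^ e → y % p ^ (e + suc t) ≡ y
        reduce y< = m<n⇒m%n≡m (<-≤-trans y< (^-monoʳ-≤ p (m≤m+n e (suc t))))
        fixed : Y q j ≡ X j
        fixed = begin
          Y q j                                 ≡⟨ reduce (digit-low {t} e<2 (digit ≤-refl j) low-last) ⟨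
          Y q j % p ^ (e + suc t)               ≡⟨ residue-term q j (e+l≤3+t (n≤1+n _)) ⟩
          (X j + q * D j) % p ^ (e + suc t)     ≡⟨ %-remove-+ʳ (X j) p∣qDj ⟩
          X j % p ^ (e + suc t)                 ≡⟨ reduce (digit-low {t} e<2 (digit z≤n j) low) ⟩
          X j                                   ∎
          where open ≡-Reasoning
        p²∣Dj : p ^ 2 ∣ D j
        p²∣Dj = *-cancelˡ-∣ q (subst (_∣ q * D j) (sym qp²≡m)
          ([x+z]%m≡x⇒m∣z (X j) (q * D j) (trans (sym (toℕ-term x d q j)) fixed)))

      -- At the indices a·p^l, the coordinates where p^(e+1) divides d do not change
      -- modulo p^(e+l+1), while the others start without a low residue.  So the
      -- number of low residues can only grow, and as it is constant no
      -- coordinate may acquire one; but low-reach would produce one.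
      ¬low : ∀ gap {l} → gap + l ≡ suc t → ∀ j → ¬ p ^ suc e ∣ D j → ¬ Low e l (X j)
      ¬low zero      refl j p∤ low = ¬low-top j p∤ low
      ¬low (suc gap) {l} eq j p∤ low
        with a , a<p , low′ ← low-reach {e} {l} (p^e∣D j) p∤ low
        = ¬low gap gap+1+l j p∤
            (count-≡⇒converse (Low? e (suc l) ∘ toℕ) x (term x d i) persists (balanced e<2 (s≤s l≤t) i≤q) j
              (low-term j low′))
        where
        gap+1+l : gap + suc l ≡ suc t
        gap+1+l = trans (+-suc gap l) eq
        l≤t : l ≤ t
        l≤t = s≤s⁻¹ (≤-trans (m≤n+m (suc l) gap) (≤-reflexive gap+1+l))
        i = a * p ^ l
        i≤q : i ≤ q
        i≤q = ≤-trans (*-monoˡ-≤ (p ^ l) (<⇒≤ a<p)) (^-monoʳ-≤ p (s≤s l≤t))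
        low-term : ∀ j → Low e (suc l) (X j + i * D j) → Low e (suc l) (Y i j)
        low-term j = subst (_< p ^ e) (sym (residue-term i j (e+l≤3+t (≤-trans (s≤s l≤t) (n≤1+n _)))))
        persists : ∀ j → Low e (suc l) (X j) → Low e (suc l) (Y i j)
        persists j low with p ^ suc e ∣? D j
        ... | no  p∤  = ⊥-elim (¬low gap gap+1+l j p∤ low)
        ... | yes p∣D = low-term j
          (low-+ {e} {suc l} (subst (_∣ i * D j) p^[l+1+e] (*-pres-∣ (n∣m*n a) p∣D)) low)
          where
          p^[l+1+e] : p ^ l * p ^ suc e ≡ p ^ (e + suc l)
          p^[l+1+e] = trans (sym (^-distribˡ-+-* p l (suc e)))
            (cong (p ^_) (trans (+-comm l (suc e)) (sym (+-suc e l))))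

      -- The descent ends at level 0, where lowness is automatic: a residue modulo p^e is below p^e.
      divisible-step : ∀ j → p ^ suc e ∣ D j
      divisible-step j with p ^ suc e ∣? D j
      ... | yes p∣D = p∣D
      ... | no  p∤  = ⊥-elim (¬low (suc t) (+-identityʳ _) j p∤ low-0)
        where
        low-0 : Low e 0 (X j)
        low-0 = <-≤-trans (m%n<n (X j) (p ^ (e + 0)) {{m^n≢0 p (e + 0)}})
          (≤-reflexive (cong (p ^_) (+-identityʳ e)))

    p²∣D : ∀ j → p ^ 2 ∣ D j
    p²∣D = divisible-step (s≤s (s≤s z≤n)) (divisible-step (s≤s z≤n) (λ j → 1∣ D j))

    last≡first : term x d q ≡ x
    last≡first = lookup-ext λ j → Fin.toℕ-injective (begin
      Y q j               ≡⟨ toℕ-term x d q j ⟩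
      (X j + q * D j) % m ≡⟨ %-remove-+ʳ (X j) (subst (_∣ q * D j) qp²≡m (*-monoʳ-∣ q (p²∣D j))) ⟩
      X j % m             ≡⟨ m<n⇒m%n≡m (Fin.toℕ<n (lookup x j)) ⟩
      X j                 ∎)
      where open ≡-Reasoning

-- Counting admissible residues, and the bound over the naturals.

module _ {p : ℕ} (p-prime : Prime p) (t : ℕ) where

  private
    instance
      p≢0 : NonZero p
      p≢0 = prime⇒nonZero p-prime
      _ = m^n≢0 p (suc t)
      _ = m^n≢0 p (2 + t)
    q = p ^ suc t
    m = p ^ (3 + t)

  digits : List (Fin m)
  digits = filter (Digit? p-prime t ∘ toℕ) (allFin m)

  -- The second list omits the multiples of p^(s-1), which are in the first one.
  nonDigits : List ℕ
  nonDigits = map (λ a → suc a * q) (upTo (pred (p * p)))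
           ++ cartesianProductWith (λ a b → suc b + suc a * p ^ (2 + t)) (upTo (pred p)) (upTo (pred p))

  length-nonDigits : length nonDigits ≡ pred (p * p) + pred p * pred p
  length-nonDigits = trans (length-++ (map _ (upTo (pred (p * p)))))
    (cong₂ _+_ (trans (length-map _ (upTo (pred (p * p)))) (length-upTo (pred (p * p))))
      (trans (length-cartesianProductWith _ (upTo (pred p)) (upTo (pred p)))
        (cong₂ _*_ (length-upTo (pred p)) (length-upTo (pred p)))))

  multiple∈nonDigits : ∀ a → 0 < a → a < p * p → a * q ∈ nonDigits
  multiple∈nonDigits (suc a) _ a<p² = ∈-++⁺ˡ (∈-map⁺ (λ a → suc a * q) (∈-upTo⁺ (pred-mono-≤ a<p²)))

  shifted∈nonDigits : ∀ a b → 0 < a → a < p → 0 < b → b < p → b + a * p ^ (2 + t) ∈ nonDigits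
  shifted∈nonDigits (suc a) (suc b) _ a<p _ b<p = ∈-++⁺ʳ (map (λ a → suc a * q) (upTo (pred (p * p))))
    (∈-cartesianProductWith⁺ (λ a b → suc b + suc a * p ^ (2 + t))
      (∈-upTo⁺ (pred-mono-≤ a<p)) (∈-upTo⁺ (pred-mono-≤ b<p)))

  -- If q divides x, then x = a·q with 0 < a < p², as 0 is admissible. Otherwise the first clause of
  -- `Digit` is vacuous, so the second fails: x = b + a·p^(s-1) with b < p, where a > 0 because x ≥
  -- p, and b > 0 because q does not divide x.
  ¬digit⇒∈nonDigits : ∀ {x} → x < m → ¬ Digit p-prime t x → x ∈ nonDigits
  ¬digit⇒∈nonDigits {x} x<m ¬digit with x % q ≟ 0
  ... | yes x%q≡0 = subst (_∈ nonDigits) (m/n*n≡m q∣x) (multiple∈nonDigits (x /ℕ q) 0<x/q x/q<p²)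
    where
    q∣x : q ∣ x
    q∣x = m%n≡0⇒n∣m x q x%q≡0
    0<x/q : 0 < x /ℕ q
    0<x/q = n≢0⇒n>0 λ x/q≡0 → ¬digit
      (subst (Digit p-prime t) (trans (sym (cong (_* q) x/q≡0)) (m/n*n≡m q∣x))
        ((λ _ → s≤s z≤n) , (λ _ → m^n>0 p 1)))
    x/q<p² : x /ℕ q < p * p
    x/q<p² = m<n*o⇒m/o<n (subst (x <_) (sym (*-assoc p p q)) x<m)
  ... | no x%q≢0 = decide (Low? p-prime 1 (suc t) x) (x <? p ^ 1)
    where
    Q = p ^ (2 + t)
    low0 : Low p-prime 0 (suc t) x → x < p ^ 0
    low0 low = ⊥-elim (x%q≢0 (n<1⇒n≡0 low))
    x≡ : x % Q + x /ℕ Q * Q ≡ x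
    x≡ = sym (m≡m%n+[m/n]*n x Q)
    decide : Dec (Low p-prime 1 (suc t) x) → Dec (x < p ^ 1) → x ∈ nonDigits
    decide (no ¬low) _         = ⊥-elim (¬digit (low0 , ⊥-elim ∘ ¬low))
    decide (yes _)   (yes x<p) = ⊥-elim (¬digit (low0 , λ _ → x<p))
    decide (yes low) (no x≮p)  = subst (_∈ nonDigits) x≡
      (shifted∈nonDigits (x /ℕ Q) (x % Q) 0<x/Q (m<n*o⇒m/o<n x<m) 0<x%Q
        (<-≤-trans low (≤-reflexive (^-identityʳ p))))
      where
      0<x/Q : 0 < x /ℕ Q
      0<x/Q = n≢0⇒n>0 λ x/Q≡0 → x≮p (subst (_< p ^ 1)
        (trans (trans (sym (+-identityʳ _)) (cong (λ a → x % Q + a * Q) (sym x/Q≡0))) x≡) low)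
      0<x%Q : 0 < x % Q
      0<x%Q = n≢0⇒n>0 λ x%Q≡0 → x%q≢0 (n∣m⇒m%n≡0 x q
        (∣-trans (^-monoʳ-∣ p (n≤1+n (suc t))) (m%n≡0⇒n∣m x Q x%Q≡0)))

  m≤length-digits : m ≤ length digits + length nonDigits
  m≤length-digits = begin
    m                                     ≡⟨ length-tabulate {n = m} (λ x → x) ⟨
    length (allFin m)                     ≡⟨ length-filter-split _ (allFin m) ⟨
    length digits + length others         ≡⟨ cong (λ z → length digits + z) (length-map toℕ others) ⟨
    length digits + length (map toℕ others)
      ≤⟨ +-monoʳ-≤ (length digits) (unique⇒length≤
           (Unique.map⁺ Fin.toℕ-injective (Unique.filter⁺ _ (Unique.allFin⁺ m))) sub) ⟩
    length digits + length nonDigits      ∎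
    where
    open ≤-Reasoning
    others = filter (¬? ∘ Digit? p-prime t ∘ toℕ) (allFin m)
    sub : ∀ {x} → x ∈ map toℕ others → x ∈ nonDigits
    sub x∈ with a , a∈ , refl ← ∈-map⁻ toℕ x∈ =
      ¬digit⇒∈nonDigits (Fin.toℕ<n a) (proj₂ (∈-filter⁻ (¬? ∘ Digit? p-prime t ∘ toℕ) {xs = allFin m} a∈))

  length-digits : m ∸ 2 * p ^ 2 + 2 * p ≤ length digits
  length-digits = begin
    m ∸ 2 * p ^ 2 + 2 * p                   ≡⟨ +-∸-comm (2 * p) 2p²≤m ⟨
    m + 2 * p ∸ 2 * p ^ 2                   ≤⟨ ∸-monoˡ-≤ (2 * p ^ 2) (+-monoˡ-≤ (2 * p) m≤length-digits) ⟩
    L + length nonDigits + 2 * p ∸ 2 * p ^ 2 ≡⟨ cong (λ z → L + z + 2 * p ∸ 2 * p ^ 2) length-nonDigits ⟩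
    L + (pred (p * p) + pred p * pred p) + 2 * p ∸ 2 * p ^ 2
      ≡⟨ cong (_∸ 2 * p ^ 2) (trans (+-assoc L _ (2 * p)) (cong (λ z → L + z) (square p))) ⟩
    L + 2 * p ^ 2 ∸ 2 * p ^ 2               ≡⟨ m+n∸n≡m L (2 * p ^ 2) ⟩
    L                                       ∎
    where
    open ≤-Reasoning
    L = length digits
    -- This makes the truncated subtraction in `m ∸ 2 * p ^ 2` the true one.
    2p²≤m : 2 * p ^ 2 ≤ m
    2p²≤m = *-mono-≤ (nonTrivial⇒n>1 p {{prime⇒nonTrivial p-prime}}) (^-monoʳ-≤ p (m≤m+n 2 t))
    square : ∀ p .{{_ : NonZero p}} → pred (p * p) + pred p * pred p + 2 * p ≡ 2 * p ^ 2
    square (suc k) = solve 1 (λ k → (k :+ k :* (con 1 :+ k)) :+ k :* k :+ con 2 :* (con 1 :+ k)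
                        := con 2 :* ((con 1 :+ k) :* ((con 1 :+ k) :* con 1))) refl k
      where open +-*-Solver

  -- The shift by one lets `l` range over `upTo (suc t)` while the levels are 1 to s - 2; at level 0
  -- every coordinate would be counted.
  statistic : ∀ {n} → ℕ → ℕ → ℤ/ m ^ n → ℕ
  statistic e l = lowCount p-prime e (suc l)

  statistics : ∀ {n} → List (ℤ/ m ^ n → ℕ)
  statistics = cartesianProductWith statistic (0 ∷ 1 ∷ []) (upTo (suc t))

  length-statistics : ∀ {n} → length (statistics {n}) ≡ 2 * suc t
  length-statistics {n} = trans
    (length-cartesianProductWith (statistic {n}) (0 ∷ 1 ∷ []) (upTo (suc t)))
    (cong (2 *_) (length-upTo (suc t)))

  statistics< : ∀ {n} → All (λ f → ∀ v → f v < suc n) (statistics {n})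
  statistics< {n} = All.tabulate λ f∈ v →
    let e , l , _ , _ , f≡ = ∈-cartesianProductWith⁻ statistic (0 ∷ 1 ∷ []) (upTo (suc t)) f∈
    in subst (λ f → f v < suc n) (sym f≡) (s≤s (count≤n (Low? p-prime e (suc l) ∘ toℕ) v))

  <2⇒∈ : ∀ {e} → e < 2 → e ∈ 0 ∷ 1 ∷ []
  <2⇒∈ {0} _ = here refl
  <2⇒∈ {1} _ = there (here refl)
  <2⇒∈ {suc (suc _)} (s≤s (s≤s ()))

  constant⇒APFree : ∀ {n} (S : List (ℤ/ m ^ n)) →
    All (λ v → ∀ j → lookup v j ∈ digits) S → All (ConstantOn S) statistics → APFree (1 + q) S
  constant⇒APFree S S⊆digits constant (x , d , proper , terms∈S) =
    -- The terms with indices 0 and q agree, so properness would force q = 0, but q is a power of p.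
    0≢1+n (trans (cong toℕ 0≡q) (trans (Fin.toℕ-fromℕ q) (sym (suc-pred q))))
    where
    term∈S : ∀ {i} → i ≤ q → term x d i ∈ S
    term∈S i≤q = subst (λ i → term x d i ∈ S) (Fin.toℕ-fromℕ< (s≤s i≤q)) (terms∈S (Fin.fromℕ< (s≤s i≤q)))
    periodic : term x d q ≡ x
    periodic = last≡first p-prime t x d
      (λ i≤q j → proj₂ (∈-filter⁻ (Digit? p-prime t ∘ toℕ) {xs = allFin m} (All.lookup S⊆digits (term∈S i≤q) j)))
      (λ e<2 l≤t i≤q →
        let v , f≡v = All.lookup constant (∈-cartesianProductWith⁺ statistic (<2⇒∈ e<2) (∈-upTo⁺ l≤t))
        in trans (All.lookup f≡v (term∈S z≤n)) (sym (All.lookup f≡v (term∈S i≤q))))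
    0≡q : Fin.zero ≡ Fin.fromℕ q
    0≡q = proper {Fin.zero} {Fin.fromℕ q} (sym (trans (cong (term x d) (Fin.toℕ-fromℕ q)) periodic))

  -- The division by (n+1)^(2(s-2)) is cleared; the exponent is the number of statistics, each of
  -- which takes at most n + 1 values.
  lower-bound : ∀ n → (m ∸ 2 * p ^ 2 + 2 * p) ^ n ≤ r (1 + q) m n * suc n ^ (2 * suc t)
  lower-bound n =
    let S , S⊆ , constant , bound = pigeonholes statistics (suc n) (vectors digits n) statistics<
        S-unique = unique-resp-⊆ S⊆ (vectors-unique (Unique.filter⁺ _ (Unique.allFin⁺ m)) n)
        S-free   = constant⇒APFree S (All-resp-⊆ S⊆ (lookup∈ n)) constant
    in begin
    (m ∸ 2 * p ^ 2 + 2 * p) ^ n          ≤⟨ ^-monoˡ-≤ n length-digits ⟩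
    length digits ^ n                    ≡⟨ length-vectors digits n ⟨
    length (vectors digits n)            ≤⟨ bound ⟩
    length S * suc n ^ length (statistics {n}) ≡⟨ cong (λ k → length S * suc n ^ k) (length-statistics {n}) ⟩
    length S * suc n ^ (2 * suc t)
      ≤⟨ *-monoˡ-≤ (suc n ^ (2 * suc t)) (proj₂ (proj₂ (maxAPFreeSize (1 + q) m n)) S S-unique S-free) ⟩
    r (1 + q) m n * suc n ^ (2 * suc t)  ∎
    where open ≤-Reasoning

-- Transfer to the rationals.

-- Given by its constructor, so that numerator and denominator compute; with c = `asℚ k` the
-- exponents in `_≥_÷_^^_` become `k` and 1.
asℚ : ℕ → ℚ
asℚ n = mkℚ (+ n) 0 (Coprimality.sym (1-coprimeTo n))

fromℕ≡asℚ : ∀ n → fromℕ n ≡ asℚ n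
fromℕ≡asℚ n = ℚ.normalize-coprime (Coprimality.sym (1-coprimeTo n))

fromℕ-* : ∀ a b → fromℕ (a * b) ≡ fromℕ a ℚ.* fromℕ b
fromℕ-* a b = trans (cong (_/ 1) (ℤ.pos-* a b)) (sym (cong₂ ℚ._*_ (fromℕ≡asℚ a) (fromℕ≡asℚ b)))

fromℕ-^ : ∀ a n → fromℕ (a ^ n) ≡ fromℕ a ^ℚ n
fromℕ-^ a zero    = refl
fromℕ-^ a (suc n) = trans (fromℕ-* a (a ^ n)) (cong (fromℕ a ℚ.*_) (fromℕ-^ a n))

fromℕ-mono-≤ : ∀ {a b} → a ≤ b → fromℕ a ℚ.≤ fromℕ b
fromℕ-mono-≤ {a} {b} a≤b = subst₂ ℚ._≤_ (sym (fromℕ≡asℚ a)) (sym (fromℕ≡asℚ b))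
  (*≤* (ℤ.*-monoʳ-≤-nonNeg (+ 1) (ℤ.+≤+ a≤b)))

½^_>0 : ∀ k → Positive (½ ^ℚ k)
½^ zero  >0 = _
½^ suc k >0 = ℚ.pos*pos⇒pos ½ (½ ^ℚ k) {{½^ k >0}}

-- `+ b / 2` is reduced to lowest terms, so the comparison is made on unnormalised fractions, by
-- cross multiplication.
asℚ≤/2 : ∀ {a b} → 2 * a ≤ b → asℚ a ℚ.≤ + b / 2
asℚ≤/2 {a} {b} 2a≤b = ℚ.toℚᵘ-cancel-≤ (ℚᵘ.≤-respʳ-≃ (ℚᵘ.≃-sym (ℚ.toℚᵘ-fromℚᵘ (ℚᵘ.mkℚᵘ (+ b) 1)))
  (ℚᵘ.*≤* (subst₂ ℤ._≤_ (ℤ.pos-* a 2) (ℤ.pos-* b 1)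
    (ℤ.+≤+ (subst₂ _≤_ (*-comm 2 a) (sym (*-identityʳ b)) 2a≤b)))))

-- From n ≥ 1 follows n + 1 ≤ 2n, so the loss (n+1)^k is at most 2^k·n^k; the factor 2^k is absorbed
-- into the constant `½ ^ℚ k`.
^-bound⇒≥÷ : ∀ N l y n k → 1 ≤ n → N ^ l ≤ y * suc n ^ k →
  y ≥ ½ ^ℚ k ℚ.* fromℕ N ^ℚ l ÷ n ^^ asℚ k
^-bound⇒≥÷ N l y n k 1≤n bound = begin
  (½ ^ℚ k ℚ.* fromℕ N ^ℚ l) ^ℚ 1          ≡⟨ ℚ.*-identityʳ _ ⟩
  ½ ^ℚ k ℚ.* fromℕ N ^ℚ l                 ≡⟨ cong (½ ^ℚ k ℚ.*_) (fromℕ-^ N l) ⟨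
  ½ ^ℚ k ℚ.* fromℕ (N ^ l)
    ≤⟨ ℚ.*-monoˡ-≤-nonNeg (½ ^ℚ k) {{ℚ.pos⇒nonNeg (½ ^ℚ k) {{½^ k >0}}}} (fromℕ-mono-≤ bound′) ⟩
  ½ ^ℚ k ℚ.* fromℕ (y * (2 * n) ^ k)
    ≡⟨ cong (½ ^ℚ k ℚ.*_) (trans (fromℕ-* y ((2 * n) ^ k)) (cong (fromℕ y ℚ.*_) (fromℕ-^ (2 * n) k))) ⟩
  ½ ^ℚ k ℚ.* (fromℕ y ℚ.* fromℕ (2 * n) ^ℚ k) ≡⟨ ℚ.*-assoc (½ ^ℚ k) (fromℕ y) _ ⟨
  ½ ^ℚ k ℚ.* fromℕ y ℚ.* fromℕ (2 * n) ^ℚ k ≡⟨ cong (ℚ._* fromℕ (2 * n) ^ℚ k) (ℚ.*-comm (½ ^ℚ k) (fromℕ y)) ⟩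
  fromℕ y ℚ.* ½ ^ℚ k ℚ.* fromℕ (2 * n) ^ℚ k ≡⟨ ℚ.*-assoc (fromℕ y) (½ ^ℚ k) _ ⟩
  fromℕ y ℚ.* (½ ^ℚ k ℚ.* fromℕ (2 * n) ^ℚ k) ≡⟨ cong (fromℕ y ℚ.*_) (^-distrib-* ½ (fromℕ (2 * n)) k) ⟨
  fromℕ y ℚ.* (½ ℚ.* fromℕ (2 * n)) ^ℚ k ≡⟨ cong (λ z → fromℕ y ℚ.* z ^ℚ k) half ⟩
  fromℕ y ℚ.* fromℕ n ^ℚ k               ≡⟨ cong (ℚ._* fromℕ n ^ℚ k) (ℚ.*-identityʳ (fromℕ y)) ⟨
  fromℕ y ^ℚ 1 ℚ.* fromℕ n ^ℚ k          ∎
  where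
  open ℚ.≤-Reasoning
  bound′ : N ^ l ≤ y * (2 * n) ^ k
  bound′ = ≤-trans bound (*-monoʳ-≤ y (^-monoˡ-≤ k
    (≤-trans (+-monoˡ-≤ n 1≤n) (≤-reflexive (cong (λ z → n + z) (sym (+-identityʳ n)))))))
  half : ½ ℚ.* fromℕ (2 * n) ≡ fromℕ n
  half = trans (cong (½ ℚ.*_) (fromℕ-* 2 n))
    (trans (sym (ℚ.*-assoc ½ (fromℕ 2) (fromℕ n))) (ℚ.*-identityˡ (fromℕ n)))

suc≤2^ : ∀ t → suc t ≤ 2 ^ t
suc≤2^ zero    = s≤s z≤n
suc≤2^ (suc t) = +-mono-≤ (m^n>0 2 t) (≤-trans (suc≤2^ t) (m≤m+n (2 ^ t) 0))

-- This is c ≤ m/2 for c = 2(s-2), with the denominator cleared.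
exponent-bound : ∀ {p} → 2 ≤ p → ∀ t → 2 * (2 * suc t) ≤ p ^ (3 + t)
exponent-bound {p} 2≤p t = begin
  2 * (2 * suc t)       ≤⟨ *-monoʳ-≤ 2 (*-monoʳ-≤ 2 (suc≤2^ t)) ⟩
  2 ^ (2 + t)           ≤⟨ ^-monoʳ-≤ 2 (n≤1+n (2 + t)) ⟩
  2 ^ (3 + t)           ≤⟨ ^-monoˡ-≤ (3 + t) 2≤p ⟩
  p ^ (3 + t)           ∎
  where open ≤-Reasoning

theorem3p15 : ∀ (p s : ℕ) → Prime p → 3 ≤ s →
    ∃₂ λ (C c : ℚ) →
    0ℚ ℚ.< C × 0ℚ ℚ.< c × c ℚ.≤ + (p ^ s) / 2 ×
    (∀ (n : ℕ) → 1 ≤ n →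
    r (1 + p ^ (s ∸ 2)) (p ^ s) n
    ≥ C ℚ.* fromℕ (p ^ s ∸ 2 * p ^ 2 + 2 * p) ^ℚ n ÷ n ^^ c)
theorem3p15 p (suc (suc (suc t))) p-prime (s≤s (s≤s (s≤s _))) =
  ½ ^ℚ k , asℚ k ,
  ℚ.positive⁻¹ (½ ^ℚ k) {{½^ k >0}} ,
  ℚ.positive⁻¹ (asℚ k) ,
  asℚ≤/2 (exponent-bound (nonTrivial⇒n>1 p {{prime⇒nonTrivial p-prime}}) t) ,
  λ n 1≤n → ^-bound⇒≥÷ (p ^ (3 + t) ∸ 2 * p ^ 2 + 2 * p) n (r (1 + p ^ suc t) (p ^ (3 + t)) n) n k
    1≤n (lower-bound p-prime t n)
  where
  -- The number of statistics, 2(s-2); it serves as c, and C is 2^(-k).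
  k = 2 * suc t
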